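{- Let $L$ be a first-order language, $\{\mathcal{A}_\lambda : \lambda\in\Lambda\}$ a family of $L$-structures, and $\mathcal{A}=\prod_{\lambda\in\Lambda}\mathcal{A}_\lambda$ the direct product. Then every definable subset of $\mathcal{A}^n$ is a finite Boolean combination of open sets in the discrete-product topology on $\mathcal{A}^n$.
   Context: "Definable" means definable by a first-order $L$-formula with parameters from $\mathcal{A}$. The direct product $\prod_\lambda\mathcal{A}_\lambda$ has universe the Cartesian product; constants and functions are interpreted coordinatewise, and a relation symbol $R$ holds of $\bar{a}$ iff it holds of $\bar{a}[\lambda]=(a_1(\lambda),\dots,a_k(\lambda))$ in $\mathcal{A}_\lambda$ for every $\lambda\in\Lambda$. The discrete-product topology on $(\prod_\lambda\mathcal{A}_\lambda)^n$ is obtained by giving each $\mathcal{A}_\lambda$ the discrete topology, taking the (Tychonoff) product topology on $\prod_\lambda\mathcal{A}_\lambda$, and then the product topology on its $n$-th power; a basis consists of the sets $\{\bar{x}\in\mathcal{A}^n : \bar{x}[\lambda]=\bar{b}[\lambda]\text{ for all }\lambda\in\Lambda_0\}$, with $\Lambda_0\subseteq\Lambda$ finite and $\bar{b}\in(\prod_{\lambda\in\Lambda_0}\mathcal{A}_\lambda)^n$. -}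

module Defs where

open import Data.List.Base using (List)
open import Data.List.Membership.Propositional using (_∈_)
open import Data.Fin.Base using (Fin)
open import Data.Nat.Base using (ℕ; suc; _+_)
open import Data.Product.Base using (Σ-syntax; ∃-syntax; _×_)
open import Data.Sum.Base using (_⊎_)
open import Data.Vec.Functional using (Vector; map; _∷_; _++_)
open import Data.Vec.Functional.Relation.Binary.Pointwise using (Pointwise)
open import Function.Bundles using (_⇔_)
open import Function.Definitions using (Congruent)
open import Level using (Level; _⊔_) renaming (suc to lsuc)
open import Relation.Binary.Bundles using (Setoid)
open import Relation.Binary.Definitions using (_Respects_)
open import Relation.Nullary.Negation.Core using (¬_)
open import Relation.Unary using (Pred; _⊆_; _≐_; ∁; _∩_; _∪_)

-- Symbols are indexed by arity; constants are the function symbols of arity 0.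
record Language (f r : Level) : Set (lsuc (f ⊔ r)) where
  field
    Fun : ℕ → Set f
    Rel : ℕ → Set r

-- The universe of a structure is a setoid, whose _≈_ is the equality of the
-- structure. This lets elements of a direct product be equal when they agree
-- coordinatewise, without assuming function extensionality. The universe is
-- allowed to be empty.
record Structure {f r : Level} (L : Language f r) (c e s : Level)
       : Set (f ⊔ r ⊔ lsuc (c ⊔ e ⊔ s)) where
  open Language L
  field
    setoid : Setoid c e
  open Setoid setoid public using (Carrier; _≈_)
  field
    fun      : ∀ {k} → Fun k → Vector Carrier k → Carrier
    fun-cong : ∀ {k} (g : Fun k) → Congruent (Pointwise _≈_) _≈_ (fun g)
    rel      : ∀ {k} → Rel k → Pred (Vector Carrier k) s
    rel-resp : ∀ {k} (R : Rel k) → rel R Respects Pointwise _≈_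

module _ {f r : Level} (L : Language f r) where
  open Language L

  -- Terms and formulas whose free variables are among n variables
  -- (de Bruijn indices).
  data Term (n : ℕ) : Set f where
    var : Fin n → Term n
    app : ∀ {k} → Fun k → Vector (Term n) k → Term n

  data Formula : ℕ → Set (f ⊔ r) where
    _≐ᶠ_ : ∀ {n} → Term n → Term n → Formula n
    relᶠ : ∀ {n k} → Rel k → Vector (Term n) k → Formula n
    ¬ᶠ_  : ∀ {n} → Formula n → Formula n
    _∧ᶠ_ : ∀ {n} → Formula n → Formula n → Formula n
    _∨ᶠ_ : ∀ {n} → Formula n → Formula n → Formula n
    _⇒ᶠ_ : ∀ {n} → Formula n → Formula n → Formula n
    ∀ᶠ_  : ∀ {n} → Formula (suc n) → Formula n
    ∃ᶠ_  : ∀ {n} → Formula (suc n) → Formula n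

module _ {f r c e s : Level} {L : Language f r} (𝒜 : Structure L c e s) where
  open Structure 𝒜

  eval : ∀ {n} → Vector Carrier n → Term L n → Carrier
  eval ρ (var i)    = ρ i
  eval ρ (app g ts) = fun g (λ j → eval ρ (ts j))

  Sat : ∀ {n} → Formula L n → Pred (Vector Carrier n) (c ⊔ e ⊔ s)
  Sat (t ≐ᶠ u)    ρ = Level.Lift (c ⊔ s) (eval ρ t ≈ eval ρ u)
  Sat (relᶠ R ts) ρ = Level.Lift (c ⊔ e) (rel R (λ j → eval ρ (ts j)))
  Sat (¬ᶠ φ)      ρ = ¬ Sat φ ρ
  Sat (φ ∧ᶠ ψ)    ρ = Sat φ ρ × Sat ψ ρ
  Sat (φ ∨ᶠ ψ)    ρ = Sat φ ρ ⊎ Sat ψ ρ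
  Sat (φ ⇒ᶠ ψ)    ρ = Sat φ ρ → Sat ψ ρ
  Sat (∀ᶠ φ)      ρ = (a : Carrier) → Sat φ (a ∷ ρ)
  Sat (∃ᶠ φ)      ρ = Σ[ a ∈ Carrier ] Sat φ (a ∷ ρ)

  -- The last m free variables of the formula are filled by parameters.
  Definable : ∀ {n p} → Pred (Vector Carrier n) p → Set (f ⊔ r ⊔ c ⊔ e ⊔ s ⊔ p)
  Definable {n} S =
    ∃[ m ] Σ[ φ ∈ Formula L (n + m) ] Σ[ b ∈ Vector Carrier m ]
      (∀ x → S x ⇔ Sat φ (x ++ b))

module _ {f r c e s i : Level} {L : Language f r} {Λ : Set i}
         (𝒜 : Λ → Structure L c e s) where
  private
    module A (l : Λ) = Structure (𝒜 l)
    module S (l : Λ) = Setoid (A.setoid l)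

  _[_] : ∀ {k} → Vector ((l : Λ) → A.Carrier l) k → (l : Λ) → Vector (A.Carrier l) k
  x [ l ] = map (λ a → a l) x

  ∏ : Structure L (i ⊔ c) (i ⊔ e) (i ⊔ s)
  ∏ = record
    { setoid = record
      { Carrier       = (l : Λ) → A.Carrier l
      ; _≈_           = λ a b → ∀ l → A._≈_ l (a l) (b l)
      ; isEquivalence = record
        { refl  = λ l → S.refl l
        ; sym   = λ p l → S.sym l (p l)
        ; trans = λ p q l → S.trans l (p l) (q l)
        }
      }
    ; fun      = λ g x l → A.fun l g (x [ l ])
    ; fun-cong = λ g p l → A.fun-cong l g (λ j → p j l)
    ; rel      = λ R x → ∀ l → A.rel l R (x [ l ])
    ; rel-resp = λ R p h l → A.rel-resp l R (λ j → p j l) (h l)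
    }

  -- The basic set of the discrete-product topology given by a finite Λ₀ ⊆ Λ and
  -- b ∈ (∏_{l ∈ Λ₀} 𝒜 l)ⁿ. The finite set is a list, possibly with repetitions;
  -- if b takes different values at two occurrences of the same index, the
  -- basic set is empty, which does not change the topology.
  Basic : ∀ {n} (Λ₀ : List Λ) → Vector ((l : Λ) → l ∈ Λ₀ → A.Carrier l) n →
          Pred (Vector (Structure.Carrier ∏) n) (i ⊔ e)
  Basic Λ₀ b x = ∀ l (l∈Λ₀ : l ∈ Λ₀) → Pointwise (A._≈_ l) (x [ l ]) (λ j → b j l l∈Λ₀)

  IsOpen : ∀ {n p} → Pred (Vector (Structure.Carrier ∏) n) p → Set (i ⊔ c ⊔ e ⊔ p)
  IsOpen {n} U = ∀ x → U x →
    Σ[ Λ₀ ∈ List Λ ] Σ[ b ∈ Vector ((l : Λ) → l ∈ Λ₀ → A.Carrier l) n ]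
      (Basic Λ₀ b x × Basic Λ₀ b ⊆ U)

data BooleanCombination {a p q : Level} {X : Set a} (𝒰 : Pred (Pred X p) q)
       : Pred X p → Set (a ⊔ lsuc p ⊔ q) where
  gen        : ∀ {U} → 𝒰 U → BooleanCombination 𝒰 U
  complement : ∀ {U} → BooleanCombination 𝒰 U → BooleanCombination 𝒰 (∁ U)
  intersect  : ∀ {U V} → BooleanCombination 𝒰 U → BooleanCombination 𝒰 V →
               BooleanCombination 𝒰 (U ∩ V)
  unite      : ∀ {U V} → BooleanCombination 𝒰 U → BooleanCombination 𝒰 V →
               BooleanCombination 𝒰 (U ∪ V)

-- Subsets are compared up to extensional equality _≐_, so that S may live in a
-- different universe from the generating sets.
IsBooleanCombinationOf : ∀ {a p q t} {X : Set a} → Pred (Pred X p) q → Pred X t →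
                         Set (a ⊔ lsuc p ⊔ q ⊔ t)
IsBooleanCombinationOf {p = p} {X = X} 𝒰 S =
  Σ[ T ∈ Pred X p ] (BooleanCombination 𝒰 T × S ≐ T)

{-# OPTIONS --safe #-}

-- Colour each coordinate l by finitely many bits computed from x[l]. By induction
-- on φ there are such a colouring and an N for which the truth of φ at x depends
-- only on the number, truncated at N, of coordinates of each colour. For a
-- quantifier, recolour l by the set of colours that a[l], x[l] can attain as a[l]
-- varies: a back-and-forth argument matches a choice of a over x by one over y when
-- the new colours have equal truncated numbers for a larger N. The sets "at least k
-- coordinates have colour d" are open, and finitely many of them determine φ.
-- Excluded middle decides untruncated Σ-types, so it also supplies the choice of
-- witnesses in all coordinates at once.
module Submission where

open import Defs
open import Axiom.ExcludedMiddle using (ExcludedMiddle)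
open import Data.Bool.Base using (Bool; true; false; not)
open import Data.Bool.Properties using (not-¬; ¬-not) renaming (_≟_ to _≟ᵇ_)
open import Data.Fin.Base using (zero; suc; splitAt)
open import Data.List.Base as List
  using (List; []; _∷_; length; filter; take; upTo; cartesianProduct)
open import Data.List.Membership.Propositional using (_∈_; _∉_; find)
open import Data.List.Membership.Propositional.Properties
  using (∈-∃++; ∈-++⁺ˡ; ∈-++⁺ʳ; ∈-++⁻; ∈-filter⁺; ∈-map⁺; ∈-upTo⁺; ∈-cartesianProduct⁺)
open import Data.List.Properties
  using (length-take; length-filter; length-map; length-++; length-++-sucʳ)
open import Data.List.Relation.Binary.Subset.Propositional using (_⊆_)
open import Data.List.Relation.Unary.All as All using (All; []; _∷_)
import Data.List.Relation.Unary.All.Properties as All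
open import Data.List.Relation.Unary.AllPairs using ([]; _∷_)
open import Data.List.Relation.Unary.Any using (here; there)
open import Data.List.Relation.Unary.Unique.Propositional using (Unique)
import Data.List.Relation.Unary.Unique.Propositional.Properties as Unique
open import Data.Nat.Base using (ℕ; zero; suc; _+_; _≤_; _<_; z≤n; s≤s)
  renaming (_⊔_ to _⊔ⁿ_)
open import Data.Nat.Properties
  using (≤-trans; ≤-reflexive; ≤-refl; <⇒≤; ≮⇒≥; n≮n; n≤1+n; m≤m+n; m≤n⇒m≤n+o; m≤n⇒m≤1+n;
         m≤m⊔n; m≤n⊔m; m≤n⇒m⊓n≡m; +-mono-≤; +-monoˡ-≤; +-cancelˡ-≤; +-suc)
open import Data.Product.Base as Product
  using (Σ-syntax; ∃; ∃-syntax; _×_; _,_; proj₁; proj₂)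
open import Data.Sum.Base as Sum using (inj₁; inj₂)
open import Data.Unit.Base using (⊤; tt)
open import Data.Vec.Base as Vec using (Vec)
open import Data.Vec.Functional as Vector using (Vector)
open import Data.Vec.Functional.Relation.Binary.Pointwise using (Pointwise)
import Data.Vec.Properties as Vec
open import Function.Base using (_∘_; id; const; case_of_)
open import Function.Bundles using (_⇔_; mk⇔; Equivalence)
open import Function.Construct.Composition using (_⇔-∘_)
open import Function.Construct.Identity using (⇔-id)
open import Level using (Level; Lift; lift; lower; 0ℓ; _⊔_)
open import Relation.Binary.Bundles using (Setoid)
open import Relation.Binary.Definitions using (_Respects_)
open import Relation.Binary.PropositionalEquality
  using (_≡_; refl; sym; trans; cong; cong₂; subst)
open import Relation.Nullary using (¬_; Dec; yes; no; does; contradiction)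
open import Relation.Nullary.Decidable using (¬?; map′; decidable-stable; does-⇔)
open import Relation.Unary using (Pred; Decidable; ∁; _∩_; _∪_)

-- Preliminaries: decidability, vectors and lists.

lowerExcludedMiddle : ∀ {a} b → ExcludedMiddle (a ⊔ b) → ExcludedMiddle a
lowerExcludedMiddle b em {P} = map′ lower lift (em {Lift b P})

does-≡⇒→ : ∀ {a b} {A : Set a} {B : Set b} (A? : Dec A) (B? : Dec B) → does A? ≡ does B? → A → B
does-≡⇒→ (yes _) (yes b) _ _ = b
does-≡⇒→ (no ¬a) _       _ a = contradiction a ¬a

take-++ : ∀ {a m n} {A : Set a} (xs : Vec A m) (ys : Vec A n) → Vec.take m (xs Vec.++ ys) ≡ xs
take-++ {m = m} xs ys = Vec.++-injectiveˡ _ xs (Vec.take++drop≡id m (xs Vec.++ ys))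

drop-++ : ∀ {a m n} {A : Set a} (xs : Vec A m) (ys : Vec A n) → Vec.drop m (xs Vec.++ ys) ≡ ys
drop-++ {m = m} xs ys = Vec.++-injectiveʳ (Vec.take m (xs Vec.++ ys)) xs (Vec.take++drop≡id m (xs Vec.++ ys))

length-filter-¬ : ∀ {a p} {A : Set a} {P : Pred A p} (P? : Decidable P) (xs : List A) →
  length xs ≡ length (filter P? xs) + length (filter (¬? ∘ P?) xs)
length-filter-¬ P? []       = refl
length-filter-¬ P? (x ∷ xs) with does (P? x)
... | true  = cong suc (length-filter-¬ P? xs)
... | false = trans (cong suc (length-filter-¬ P? xs)) (sym (+-suc _ _))

length-filter-map : ∀ {a b c p} {A : Set a} {B : Set b} {C : Set c} {P : Pred C p} (P? : Decidable P)
  (f : A → C) (g : B → C) (xs : List A) (ys : List B) → List.map f xs ≡ List.map g ys →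
  length (filter (P? ∘ f) xs) ≡ length (filter (P? ∘ g) ys)
length-filter-map P? f g xs ys eq = trans (go f xs) (trans (cong (length ∘ filter P?) eq) (sym (go g ys)))
  where
  go : ∀ {d} {D : Set d} (h : D → _) (zs : List D) →
    length (filter (P? ∘ h) zs) ≡ length (filter P? (List.map h zs))
  go h []       = refl
  go h (z ∷ zs) with does (P? (h z))
  ... | true  = cong suc (go h zs)
  ... | false = go h zs

-- Cut one occurrence of the head out of `ys`: since `xs` has no repetitions, its tail lies in what
-- is left, and induction applies.
unique⊆⇒length≤ : ∀ {a} {A : Set a} {xs ys : List A} → Unique xs → xs ⊆ ys → length xs ≤ length ys
unique⊆⇒length≤ []         _     = z≤n
unique⊆⇒length≤ {xs = x ∷ xs} (x≢ ∷ uxs) xs⊆ys with ∈-∃++ (xs⊆ys (here refl))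
... | us , vs , refl = ≤-trans (s≤s (unique⊆⇒length≤ uxs xs⊆))
                               (≤-reflexive (sym (length-++-sucʳ us x vs)))
  where
  xs⊆ : xs ⊆ us List.++ vs
  xs⊆ z∈ with ∈-++⁻ us (xs⊆ys (there z∈))
  ... | inj₁ z∈us         = ∈-++⁺ˡ z∈us
  ... | inj₂ (here z≡x)   = contradiction (sym z≡x) (All.lookup x≢ z∈)
  ... | inj₂ (there z∈vs) = ∈-++⁺ʳ us z∈vs

-- Truncated sizes of subsets of `Λ`.

module Counting {i} {Λ : Set i} (em : ExcludedMiddle i) where

  -- A repetition-free list as witness bounds sizes from below without a cardinality function, so
  -- infinite sets need no separate case.
  AtLeast : ℕ → Pred Λ 0ℓ → Set i
  AtLeast k P = Σ[ ls ∈ List Λ ] Unique ls × All P ls × k ≤ length ls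

  private
    _∈?_ : ∀ l (ls : List Λ) → Dec (l ∈ ls)
    l ∈? ls = em

  pigeonhole : ∀ {as bs : List Λ} → Unique as → length bs < length as → ∃[ a ] a ∈ as × a ∉ bs
  pigeonhole {as} {bs} uas bs<as with All.all? (_∈? bs) as
  ... | yes as⊆bs = contradiction (≤-trans bs<as (unique⊆⇒length≤ uas (All.lookup as⊆bs))) (n≮n _)
  ... | no  as⊈bs = find (All.¬All⇒Any¬ (_∈? bs) as as⊈bs)

  exactly : ∀ {k P} → AtLeast k P → Σ[ ls ∈ List Λ ] Unique ls × All P ls × length ls ≡ k
  exactly {k} (ls , uls , Pls , k≤) =
    take k ls , Unique.take⁺ k uls , All.take⁺ k Pls , trans (length-take k ls) (m≤n⇒m⊓n≡m k≤)

  AtLeast-≤ : ∀ {j k P} → j ≤ k → AtLeast k P → AtLeast j P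
  AtLeast-≤ j≤k (ls , uls , Pls , k≤) = ls , uls , Pls , ≤-trans j≤k k≤

  AtLeast-⊆ : ∀ {k P Q} → (∀ {l} → P l → Q l) → AtLeast k P → AtLeast k Q
  AtLeast-⊆ P⊆Q (ls , uls , Pls , k≤) = ls , uls , All.map P⊆Q Pls , k≤

  AtLeast-zero : ∀ {P} → AtLeast 0 P
  AtLeast-zero = [] , [] , [] , z≤n

  -- Excluded middle is applied at `N - 1`, `N - 2` and so on until the exact size `j` is met; size
  -- 0 always stops the search.
  AtLeast-threshold : ∀ {N P} → ¬ AtLeast N P → ∃[ j ] j < N × AtLeast j P × ¬ AtLeast (suc j) P
  AtLeast-threshold {zero}      ¬N = contradiction AtLeast-zero ¬N
  AtLeast-threshold {suc N} {P} ¬N with em {AtLeast N P}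
  ... | yes N≤ = N , ≤-refl , N≤ , ¬N
  ... | no  ¬N′ with AtLeast-threshold ¬N′
  ...   | j , j<N , p , ¬p = j , m≤n⇒m≤1+n j<N , p , ¬p

  Part : Pred Λ 0ℓ → (Λ → Bool) → Bool → Pred Λ 0ℓ
  Part P U b l = P l × U l ≡ b

  Part-merge : ∀ {P U j k} b → AtLeast j (Part P U b) → AtLeast k (Part P U (not b)) → AtLeast (j + k) P
  Part-merge b (as , uas , Pas , j≤) (bs , ubs , Pbs , k≤) =
    as List.++ bs ,
    Unique.++⁺ uas ubs (λ (x , y) → not-¬ refl (trans (sym (proj₂ (All.lookup Pas x))) (proj₂ (All.lookup Pbs y)))) ,
    All.++⁺ (All.map proj₁ Pas) (All.map proj₁ Pbs) ,
    ≤-trans (+-mono-≤ j≤ k≤) (≤-reflexive (sym (length-++ as)))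

  -- Among `j + k` elements of `P` at most `j` carry the bit `b`, so discarding those leaves at
  -- least `k`.
  Part-remainder : ∀ {P U j k} b → AtLeast (j + k) P → ¬ AtLeast (suc j) (Part P U b) → AtLeast k (Part P U (not b))
  Part-remainder {P} {U} {j} {k} b (ls , uls , Pls , j+k≤) few =
    filter (¬? ∘ U?) ls , Unique.filter⁺ (¬? ∘ U?) uls ,
    All.zipWith (λ (p , u) → p , ¬-not u) (All.filter⁺ (¬? ∘ U?) Pls , All.all-filter (¬? ∘ U?) ls) ,
    +-cancelˡ-≤ j _ _ (≤-trans j+k≤ (≤-trans (≤-reflexive (length-filter-¬ U? ls)) (+-monoˡ-≤ _ few′)))
    where
    U? : Decidable (λ l → U l ≡ b)
    U? l = U l ≟ᵇ b

    few′ : length (filter U? ls) ≤ j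
    few′ = ≮⇒≥ λ j< → few
      ( filter U? ls , Unique.filter⁺ U? uls
      , All.zipWith id (All.filter⁺ U? Pls , All.all-filter U? ls) , j<)

  -- `U` marks with `b` precisely the elements of a list of length `j`. A repetition-free list of
  -- marked elements lies inside that list, so it is no longer.
  Part-choose : ∀ {P j} b → AtLeast j P →
    Σ[ U ∈ (Λ → Bool) ] AtLeast j (Part P U b) × ¬ AtLeast (suc j) (Part P U b)
  Part-choose {P} {j} b p with exactly p
  ... | ls , uls , Pls , refl = U , (ls , uls , All.tabulate (λ l∈ → All.lookup Pls l∈ , U-in l∈) , ≤-refl) ,
    λ (as , uas , Pas , j<) →
      n≮n _ (≤-trans j< (unique⊆⇒length≤ uas (λ a∈ → in-U (proj₂ (All.lookup Pas a∈)))))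
    where
    U : Λ → Bool
    U l with l ∈? ls
    ... | yes _ = b
    ... | no  _ = not b

    U-in : ∀ {l} → l ∈ ls → U l ≡ b
    U-in {l} l∈ with l ∈? ls
    ... | yes _  = refl
    ... | no  l∉ = contradiction l∈ l∉

    in-U : ∀ {l} → U l ≡ b → l ∈ ls
    in-U {l} eq with l ∈? ls
    ... | yes l∈ = l∈
    ... | no  _  = contradiction (sym eq) (not-¬ refl)

  infix 4 _≲⟨_⟩_ _≈⟨_⟩_ _∼⟨_⟩_

  -- In terms of sizes this is min(|P|, N) ≤ min(|Q|, N).
  _≲⟨_⟩_ : Pred Λ 0ℓ → ℕ → Pred Λ 0ℓ → Set i
  P ≲⟨ N ⟩ Q = ∀ {k} → k ≤ N → AtLeast k P → AtLeast k Q

  _≈⟨_⟩_ : Pred Λ 0ℓ → ℕ → Pred Λ 0ℓ → Set i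
  P ≈⟨ N ⟩ Q = P ≲⟨ N ⟩ Q × Q ≲⟨ N ⟩ P

  -- The bound `N + N` covers both parts at once. The parts of bit `b` have exactly `j ≤ N` elements
  -- on both sides; `k ≤ N` elements of the other part are transferred by adding these `j`, passing
  -- from `P` to `Q`, and removing the elements of bit `b` again.
  Part-≲ : ∀ {P Q U V N j} b → P ≲⟨ N + N ⟩ Q → j ≤ N →
    AtLeast j (Part P U b) → ¬ AtLeast (suc j) (Part P U b) →
    AtLeast j (Part Q V b) → ¬ AtLeast (suc j) (Part Q V b) →
    ∀ b′ → Part P U b′ ≲⟨ N ⟩ Part Q V b′
  Part-≲ {j = j} b P≲Q j≤N p ¬p q ¬q b′ {k} k≤N pk with b′ ≟ᵇ b
  ... | yes refl = AtLeast-≤ (≮⇒≥ λ j<k → ¬p (AtLeast-≤ j<k pk)) q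
  ... | no  b′≢b with refl ← ¬-not b′≢b =
    Part-remainder b (P≲Q (+-mono-≤ j≤N k≤N) (Part-merge b p pk)) ¬q

  Part-≲-large : ∀ {P Q : Pred Λ 0ℓ} {N} → AtLeast N Q → P ≲⟨ N ⟩ Q
  Part-≲-large q k≤N _ = AtLeast-≤ k≤N q

  -- If one part of P has fewer than N elements, copy its exact size to Q;
  -- otherwise Q has at least N + N elements, and any N of them form one part.
  Part-extend : ∀ {P Q N} → P ≈⟨ N + N ⟩ Q → (U : Λ → Bool) →
    Σ[ V ∈ (Λ → Bool) ] (∀ b → Part P U b ≈⟨ N ⟩ Part Q V b)
  Part-extend {P} {Q} {N} (P≲Q , Q≲P) U with em {∃[ b ] ¬ AtLeast N (Part P U b)}
  ... | yes (b , few) with AtLeast-threshold few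
  ...   | j , j<N , p , ¬p with Part-choose b (P≲Q (m≤n⇒m≤n+o N (<⇒≤ j<N)) (AtLeast-⊆ proj₁ p))
  ...     | V , q , ¬q = V , λ b′ →
    Part-≲ b P≲Q (<⇒≤ j<N) p ¬p q ¬q b′ , Part-≲ b Q≲P (<⇒≤ j<N) q ¬q p ¬p b′
  Part-extend {P} {Q} {N} (P≲Q , Q≲P) U | no many =
    V , λ b → Part-≲-large (Q-large b) , Part-≲-large (P-large b)
    where
    P-large : ∀ b → AtLeast N (Part P U b)
    P-large b = decidable-stable em λ few → many (b , few)

    Q-size : AtLeast (N + N) Q
    Q-size = P≲Q ≤-refl (Part-merge true (P-large true) (P-large false))

    choice : Σ[ V ∈ (Λ → Bool) ] AtLeast N (Part Q V true) × ¬ AtLeast (suc N) (Part Q V true)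
    choice = Part-choose true (AtLeast-≤ (m≤m+n N N) Q-size)

    V : Λ → Bool
    V = proj₁ choice

    Q-large : ∀ b → AtLeast N (Part Q V b)
    Q-large true  = proj₁ (proj₂ choice)
    Q-large false = Part-remainder true Q-size (proj₂ (proj₂ choice))

  -- Colourings of `Λ` with equal truncated colour counts.

  Fibre : {C : Set} → (Λ → C) → C → Pred Λ 0ℓ
  Fibre χ c l = χ l ≡ c

  _∼⟨_⟩_ : {C : Set} → (Λ → C) → ℕ → (Λ → C) → Set i
  χ ∼⟨ N ⟩ χ′ = ∀ c → Fibre χ c ≈⟨ N ⟩ Fibre χ′ c

  ∼-sym : ∀ {C N} {χ χ′ : Λ → C} → χ ∼⟨ N ⟩ χ′ → χ′ ∼⟨ N ⟩ χ
  ∼-sym χ∼χ′ c = proj₂ (χ∼χ′ c) , proj₁ (χ∼χ′ c)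

  ∼-≤ : ∀ {C M N} {χ χ′ : Λ → C} → M ≤ N → χ ∼⟨ N ⟩ χ′ → χ ∼⟨ M ⟩ χ′
  ∼-≤ M≤N χ∼χ′ c = (λ k≤M → proj₁ (χ∼χ′ c) (≤-trans k≤M M≤N)) , (λ k≤M → proj₂ (χ∼χ′ c) (≤-trans k≤M M≤N))

  ∼-occurs : ∀ {C N} {χ χ′ : Λ → C} → 1 ≤ N → χ ∼⟨ N ⟩ χ′ → ∀ l → ∃[ l₀ ] χ l₀ ≡ χ′ l
  ∼-occurs {χ′ = χ′} 1≤N χ∼χ′ l with proj₂ (χ∼χ′ (χ′ l)) 1≤N (l ∷ [] , [] ∷ [] , refl ∷ [] , ≤-refl)
  ... | l₀ ∷ _ , _ , eq ∷ _ , _ = l₀ , eq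

  ∼-realize : ∀ {C N} {χ χ′ : Λ → C} → χ ∼⟨ N ⟩ χ′ → ∀ {ls} → Unique ls → length ls ≤ N →
    Σ[ ls′ ∈ List Λ ] Unique ls′ × List.map χ ls ≡ List.map χ′ ls′
  ∼-realize _ [] _ = [] , [] , refl
  ∼-realize {C} {χ = χ} {χ′} χ∼χ′ {l ∷ ls} (l≢ ∷ uls) |ls|<N
    with ∼-realize χ∼χ′ uls (<⇒≤ |ls|<N)
  ... | ls′ , uls′ , eq = new
    where
    c? : Decidable (_≡ χ l)
    c? d = lowerExcludedMiddle i em

    same same′ : List Λ
    same  = filter (c? ∘ χ) ls
    same′ = filter (c? ∘ χ′) ls′

    uniqueSame : Unique (l ∷ same)
    uniqueSame = All.filter⁺ (c? ∘ χ) l≢ ∷ Unique.filter⁺ (c? ∘ χ) uls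

    new : Σ[ ls″ ∈ List Λ ] Unique ls″ × χ l ∷ List.map χ ls ≡ List.map χ′ ls″
    -- Together with `l`, the coordinates of its colour in `ls` show that `χ′` takes this colour at
    -- more places than `ls′` has used, so one of them is fresh.
    new with proj₁ (χ∼χ′ (χ l)) (≤-trans (s≤s (length-filter (c? ∘ χ) ls)) |ls|<N)
               (l ∷ same , uniqueSame , refl ∷ All.all-filter (c? ∘ χ) ls , ≤-refl)
    ... | as , uas , χ′as , same<as
      with pigeonhole {bs = same′} uas
             (≤-trans (≤-reflexive (cong suc (sym (length-filter-map c? χ χ′ ls ls′ eq)))) same<as)
    ...   | a , a∈ , a∉ =
      a ∷ ls′ ,
      All.tabulate (λ { x∈ refl → a∉ (∈-filter⁺ (c? ∘ χ′) x∈ (All.lookup χ′as a∈)) }) ∷ uls′ ,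
      cong₂ _∷_ (sym (All.lookup χ′as a∈)) eq

  -- A fibre of `ψ` may meet many fibres of `χ`. Matching its listed elements individually by
  -- `∼-realize` avoids summing counts over colours.
  Fibre-coarsen : ∀ {C D N} {χ χ′ : Λ → C} {ψ ψ′ : Λ → D} (h : C → D) →
    (∀ l → ψ l ≡ h (χ l)) → (∀ l → ψ′ l ≡ h (χ′ l)) →
    χ ∼⟨ N ⟩ χ′ → ∀ d → Fibre ψ d ≲⟨ N ⟩ Fibre ψ′ d
  Fibre-coarsen {χ = χ} {χ′} h ψ≡ ψ′≡ χ∼χ′ d k≤N p with exactly p
  ... | ls , uls , ψls , refl with ∼-realize χ∼χ′ uls k≤N
  ...   | ls′ , uls′ , eq =
    ls′ , uls′ ,
    All.map (λ {l} → trans (ψ′≡ l))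
      (All.map⁻ (subst (All (λ c → h c ≡ d)) eq (All.map⁺ (All.map (λ {l} → trans (sym (ψ≡ l))) ψls)))) ,
    ≤-reflexive (trans (sym (length-map χ ls)) (trans (cong length eq) (length-map χ′ ls′)))

  -- The factorisations are only pointwise; with `h = id` this replaces colourings by pointwise
  -- equal ones, in place of function extensionality.
  ∼-coarsen : ∀ {C D N} {χ χ′ : Λ → C} {ψ ψ′ : Λ → D} (h : C → D) →
    (∀ l → ψ l ≡ h (χ l)) → (∀ l → ψ′ l ≡ h (χ′ l)) →
    χ ∼⟨ N ⟩ χ′ → ψ ∼⟨ N ⟩ ψ′
  ∼-coarsen h ψ≡ ψ′≡ χ∼χ′ d =
    Fibre-coarsen h ψ≡ ψ′≡ χ∼χ′ d , Fibre-coarsen h ψ′≡ ψ≡ (∼-sym χ∼χ′) d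

  ∼-extendBool : ∀ {C N} {χ χ′ : Λ → C} → χ ∼⟨ N + N ⟩ χ′ → (U : Λ → Bool) →
    Σ[ V ∈ (Λ → Bool) ] (λ l → χ l , U l) ∼⟨ N ⟩ (λ l → χ′ l , V l)
  ∼-extendBool {C} {N} {χ} {χ′} χ∼χ′ U = V , λ (c , b) →
    (λ k≤N → AtLeast-⊆ fromV ∘ proj₁ (proj₂ (part c) b) k≤N ∘ AtLeast-⊆ (λ { refl → refl , refl })) ,
    (λ k≤N → AtLeast-⊆ (λ { (refl , refl) → refl }) ∘ proj₂ (proj₂ (part c) b) k≤N ∘ AtLeast-⊆ (λ { refl → refl , refl }))
    where
    part : ∀ c → Σ[ V ∈ (Λ → Bool) ] (∀ b → Part (Fibre χ c) U b ≈⟨ N ⟩ Part (Fibre χ′ c) V b)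
    part c = Part-extend (χ∼χ′ c) U

    V : Λ → Bool
    -- The choices made fibre by fibre glue, because `l` lies in the fibre of `χ′ l` and in no
    -- other.
    V l = proj₁ (part (χ′ l)) l

    fromV : ∀ {c b l} → Part (Fibre χ′ c) (proj₁ (part c)) b l → (χ′ l , V l) ≡ (c , b)
    fromV (refl , refl) = refl

  -- This is 2^m N: each of `m` extra bits halves the truncation bound.
  doubled : ℕ → ℕ → ℕ
  doubled zero    N = N
  doubled (suc m) N = doubled m N + doubled m N

  ∼-extend : ∀ m {C N} {χ χ′ : Λ → C} → χ ∼⟨ doubled m N ⟩ χ′ → (ψ : Λ → Vec Bool m) →
    Σ[ ψ′ ∈ (Λ → Vec Bool m) ] (λ l → χ l , ψ l) ∼⟨ N ⟩ (λ l → χ′ l , ψ′ l)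
  ∼-extend zero χ∼χ′ ψ = ψ , ∼-coarsen (_, Vec.[]) (λ l → eq (ψ l)) (λ l → eq (ψ l)) χ∼χ′
    where
    eq : ∀ {C : Set} {c : C} (v : Vec Bool 0) → (c , v) ≡ (c , Vec.[])
    eq Vec.[] = refl
  ∼-extend (suc m) χ∼χ′ ψ
    with ∼-extendBool χ∼χ′ (Vec.head ∘ ψ)
  ... | V , χV∼ with ∼-extend m χV∼ (Vec.tail ∘ ψ)
  ...   | ψ′ , χψ∼ = (λ l → V l Vec.∷ ψ′ l) ,
    ∼-coarsen (λ ((c , b) , v) → c , b Vec.∷ v) (λ l → cong (_ ,_) (eq (ψ l))) (λ _ → refl) χψ∼
    where
    eq : ∀ {k} (v : Vec Bool (suc k)) → v ≡ Vec.head v Vec.∷ Vec.tail v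
    eq (_ Vec.∷ _) = refl

-- Enumeration of the finitely many colours.

booleanVectors : ∀ m → List (Vec Bool m)
booleanVectors zero    = Vec.[] ∷ []
booleanVectors (suc m) =
  List.map (true Vec.∷_) (booleanVectors m) List.++ List.map (false Vec.∷_) (booleanVectors m)

∈-booleanVectors : ∀ {m} (v : Vec Bool m) → v ∈ booleanVectors m
∈-booleanVectors Vec.[]            = here refl
∈-booleanVectors (true  Vec.∷ v) = ∈-++⁺ˡ (∈-map⁺ _ (∈-booleanVectors v))
∈-booleanVectors (false Vec.∷ v) = ∈-++⁺ʳ _ (∈-map⁺ _ (∈-booleanVectors v))

map-fromList-injective : ∀ {a b} {A : Set a} {B : Set b} {f g : A → B} {xs : List A} →
  Vec.map f (Vec.fromList xs) ≡ Vec.map g (Vec.fromList xs) → ∀ {x} → x ∈ xs → f x ≡ g x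
map-fromList-injective eq (here refl) = cong Vec.head eq
map-fromList-injective eq (there x∈) = map-fromList-injective (cong Vec.tail eq) x∈

-- Sets determined by finitely many generators.

module _ {x p} {X : Set x} {I : Set} (U : I → Pred X (x ⊔ p)) where

  Agree : List I → X → X → Set (x ⊔ p)
  Agree G y z = All (λ j → U j y ⇔ U j z) G

  Saturated : List I → Pred X (x ⊔ p) → Set (x ⊔ p)
  Saturated G S = ∀ {y z} → Agree G y z → S y → S z

  -- Induction on `G`: with no generators left, `S` is empty or everything; otherwise `S` is split
  -- along `U j` and its complement.
  saturated⇒booleanCombination : ∀ {q} → ExcludedMiddle (x ⊔ p) → {𝒰 : Pred (Pred X (x ⊔ p)) q} →
    (∀ j → 𝒰 (U j)) → 𝒰 (const (Lift _ ⊤)) →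
    ∀ G {S} → Saturated G S → IsBooleanCombinationOf 𝒰 S
  saturated⇒booleanCombination em 𝒰U 𝒰X [] {S} sat with em {∃ S}
  ... | yes (y , Sy) = _ , gen 𝒰X , (λ _ → lift tt) , (λ _ → sat [] Sy)
  ... | no  empty    = _ , complement (gen 𝒰X) , (λ Sy _ → empty (_ , Sy)) , (λ ¬⊤ → contradiction (lift tt) ¬⊤)
  saturated⇒booleanCombination em {𝒰} 𝒰U 𝒰X (j ∷ G) {S} sat =
    let T⁺ , bc⁺ , S⁺⊆T⁺ , T⁺⊆S⁺ = part (U j)
        T⁻ , bc⁻ , S⁻⊆T⁻ , T⁻⊆S⁻ = part (∁ (U j))
    in  (U j ∩ T⁺) ∪ (∁ (U j) ∩ T⁻) ,
        unite (intersect (gen (𝒰U j)) bc⁺) (intersect (complement (gen (𝒰U j))) bc⁻) ,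
        (λ {y} Sy → case em {U j y} of λ
          { (yes u) → inj₁ (u , S⁺⊆T⁺ (y , u , Sy , All.universal (λ _ → ⇔-id _) G))
          ; (no ¬u) → inj₂ (¬u , S⁻⊆T⁻ (y , ¬u , Sy , All.universal (λ _ → ⇔-id _) G)) }) ,
        -- The given point and `y` both lie in `U j`, so they agree on all of `j ∷ G` and the
        -- saturation of `S` applies.
        λ { (inj₁ (u , t)) → let y , v , Sy , y~z = T⁺⊆S⁺ t in
              sat (mk⇔ (const u) (const v) ∷ y~z) Sy
          ; (inj₂ (¬u , t)) → let y , ¬v , Sy , y~z = T⁻⊆S⁻ t in
              sat (mk⇔ (λ v → contradiction v ¬v) (λ u → contradiction u ¬u) ∷ y~z) Sy }
    where
    -- The half `S ∩ V` need not be saturated for the shorter list `G`, so the induction is applied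
    -- to its saturation.
    SaturationOf : Pred X _ → Pred X _
    SaturationOf V z = ∃[ y ] V y × S y × Agree G y z

    part : ∀ V → IsBooleanCombinationOf 𝒰 (SaturationOf V)
    part V = saturated⇒booleanCombination em 𝒰U 𝒰X G λ y~z (w , v , Sw , w~y) →
      w , v , Sw , All.zipWith (λ (f , g) → g ⇔-∘ f) (w~y , y~z)

-- Colourings computed from the coordinates of a tuple.

module _ {f r c e s i} (em : ExcludedMiddle (i ⊔ c ⊔ e ⊔ s)) {L : Language f r} {Λ : Set i}
         (𝒜 : Λ → Structure L c e s) where
  private
    module A (l : Λ) = Structure (𝒜 l)
    module S (l : Λ) = Setoid (A.setoid l)

    w : Level
    w = i ⊔ c ⊔ e ⊔ s

    em-i : ExcludedMiddle i
    em-i = lowerExcludedMiddle w em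

    em-c : ExcludedMiddle c
    em-c = lowerExcludedMiddle w em

    Elements : ℕ → Set (i ⊔ c)
    Elements = Vector (Structure.Carrier (∏ 𝒜))

    π : ∀ {n} → Elements n → (l : Λ) → Vector (A.Carrier l) n
    π = _[_] 𝒜

  open Counting {Λ = Λ} em-i

  -- All coordinates share one palette of bit vectors of a fixed length, so the colours can be
  -- listed, and a set of colours can itself be coded as a bit vector.
  record Colouring (n : ℕ) : Set (i ⊔ c ⊔ e) where
    field
      bits    : ℕ
      colour  : ∀ l → Vector (A.Carrier l) n → Vec Bool bits
      respect : ∀ l {v u} → Pointwise (A._≈_ l) v u → colour l v ≡ colour l u

    colourOf : Elements n → Λ → Vec Bool bits
    colourOf x l = colour l (π x l)

  open Colouring

  -- One implication suffices, since symmetry of `∼` yields the converse.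
  Determined : ∀ {n p} → Colouring n → ℕ → Pred (Elements n) p → Set (i ⊔ c ⊔ p)
  Determined κ N P = ∀ {x y} → colourOf κ x ∼⟨ N ⟩ colourOf κ y → P x → P y

  FinitelyDetermined : ∀ {n p} → Pred (Elements n) p → Set (i ⊔ c ⊔ e ⊔ p)
  FinitelyDetermined {n} P = Σ[ κ ∈ Colouring n ] Σ[ N ∈ ℕ ] Determined κ N P

  FinitelyDetermined-⇔ : ∀ {n p q} {P : Pred (Elements n) p} {Q : Pred (Elements n) q} →
    (∀ x → P x ⇔ Q x) → FinitelyDetermined P → FinitelyDetermined Q
  FinitelyDetermined-⇔ P⇔Q (κ , N , det) =
    κ , N , λ x∼y → Equivalence.to (P⇔Q _) ∘ det x∼y ∘ Equivalence.from (P⇔Q _)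

  -- One bit records whether `Q l` holds. The condition fails exactly when the bit `false` occurs at
  -- some coordinate, which truncation at 1 detects.
  finitelyDetermined-coordinatewise : ∀ {n p} {Q : ∀ l → Pred (Vector (A.Carrier l) n) p} → ExcludedMiddle p →
    (∀ l → Q l Respects Pointwise (A._≈_ l)) →
    FinitelyDetermined (λ x → ∀ l → Q l (π x l))
  finitelyDetermined-coordinatewise {n} {Q = Q} em-p resp = κ , 1 , λ {x} {y} x∼y all l →
    let l₀ , same = ∼-occurs ≤-refl x∼y l in
    does-≡⇒→ (em-p {Q l₀ (π x l₀)}) em-p (cong Vec.head same) (all l₀)
    where
    κ : Colouring n
    κ = record
      { bits    = 1
      ; colour  = λ l v → does (em-p {Q l v}) Vec.∷ Vec.[]
      ; respect = λ l v≈u → cong (Vec._∷ Vec.[])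
          (does-⇔ (mk⇔ (resp l v≈u) (resp l (λ j → S.sym l (v≈u j)))) em-p em-p)
      }

  _⊗_ : ∀ {n} → Colouring n → Colouring n → Colouring n
  κ ⊗ μ = record
    { bits    = bits κ + bits μ
    ; colour  = λ l v → colour κ l v Vec.++ colour μ l v
    ; respect = λ l v≈u → cong₂ Vec._++_ (respect κ l v≈u) (respect μ l v≈u)
    }

  ⊗-fst : ∀ {n} (κ μ : Colouring n) {N x y} →
    colourOf (κ ⊗ μ) x ∼⟨ N ⟩ colourOf (κ ⊗ μ) y → colourOf κ x ∼⟨ N ⟩ colourOf κ y
  ⊗-fst κ μ = ∼-coarsen (Vec.take (bits κ)) (λ l → sym (take-++ _ _)) (λ l → sym (take-++ _ _))

  ⊗-snd : ∀ {n} (κ μ : Colouring n) {N x y} →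
    colourOf (κ ⊗ μ) x ∼⟨ N ⟩ colourOf (κ ⊗ μ) y → colourOf μ x ∼⟨ N ⟩ colourOf μ y
  ⊗-snd κ μ = ∼-coarsen (Vec.drop (bits κ)) (λ l → sym (drop-++ (colour κ _ _) _)) (λ l → sym (drop-++ (colour κ _ _) _))

  determined-⊗ : ∀ {n p q} {P : Pred (Elements n) p} {Q : Pred (Elements n) q} →
    FinitelyDetermined P → FinitelyDetermined Q →
    Σ[ κ ∈ Colouring n ] Σ[ N ∈ ℕ ] Determined κ N P × Determined κ N Q
  determined-⊗ (κ , M , P-det) (μ , N , Q-det) =
    κ ⊗ μ , M ⊔ⁿ N ,
    (λ x∼y → P-det (⊗-fst κ μ (∼-≤ (m≤m⊔n M N) x∼y))) ,
    (λ x∼y → Q-det (⊗-snd κ μ (∼-≤ (m≤n⊔m M N) x∼y)))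

  π-∷ : ∀ {n} a (x : Elements n) l → Pointwise (A._≈_ l) (a l Vector.∷ π x l) (π (a Vector.∷ x) l)
  π-∷ a x l zero    = S.refl l
  π-∷ a x l (suc j) = S.refl l

  ∷-resp : ∀ {n} l a {v u : Vector (A.Carrier l) n} → Pointwise (A._≈_ l) v u →
    Pointwise (A._≈_ l) (a Vector.∷ v) (a Vector.∷ u)
  ∷-resp l a v≈u zero    = S.refl l
  ∷-resp l a v≈u (suc j) = v≈u j

  -- Quantifiers: the back-and-forth argument.

  module _ {n} (κ : Colouring (suc n)) where

    Attains : ∀ l → Vector (A.Carrier l) n → Vec Bool (bits κ) → Set c
    Attains l v b = ∃[ a ] colour κ l (a Vector.∷ v) ≡ b

    private
      attains? : ∀ l v b → Dec (Attains l v b)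
      attains? l v b = em-c

    -- The colour is the indicator vector of a set of `κ`-colours, with one bit for each of them.
    attainable : Colouring n
    attainable = record
      { bits    = length (booleanVectors (bits κ))
      ; colour  = λ l v → Vec.map (does ∘ attains? l v) (Vec.fromList (booleanVectors (bits κ)))
      ; respect = λ l {v} {u} v≈u → Vec.map-cong (λ b → does-⇔
          (mk⇔ (λ (a , eq) → a , trans (sym (respect κ l (∷-resp l a v≈u))) eq)
               (λ (a , eq) → a , trans (respect κ l (∷-resp l a v≈u)) eq))
          (attains? l v b) (attains? l u b)) _
      }

    -- The colours produced by `a` refine the colouring of `x`, and `∼-extend` transfers this
    -- refinement to `y`, using up the doublings. As `N` is positive, every colour demanded over `y`
    -- already occurs over `x`.
    back-and-forth : ∀ {N x y} → 1 ≤ N →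
      colourOf attainable x ∼⟨ doubled (bits κ) N ⟩ colourOf attainable y →
      ∀ a → ∃[ b ] colourOf κ (a Vector.∷ x) ∼⟨ N ⟩ colourOf κ (b Vector.∷ y)
    back-and-forth {N} {x} {y} 1≤N x∼y a = b ,
      ∼-coarsen proj₂ (λ _ → refl) (λ l → trans (sym (respect κ l (π-∷ b y l))) (proj₂ (witness l))) xψ∼yψ′
      where
      ψ : Λ → Vec Bool (bits κ)
      ψ = colourOf κ (a Vector.∷ x)

      extension : Σ[ ψ′ ∈ (Λ → Vec Bool (bits κ)) ] _ ∼⟨ N ⟩ _
      extension = ∼-extend (bits κ) x∼y ψ

      ψ′ : Λ → Vec Bool (bits κ)
      ψ′ = proj₁ extension

      xψ∼yψ′ : (λ l → colourOf attainable x l , ψ l) ∼⟨ N ⟩ (λ l → colourOf attainable y l , ψ′ l)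
      xψ∼yψ′ = proj₂ extension

      witness : ∀ l → Attains l (π y l) (ψ′ l)
      witness l =
        -- At `l₀` the colour `ψ′ l` is attained by `a l₀`. The sets of attainable colours at `l₀`
        -- over `x` and at `l` over `y` coincide, so it is attained at `l` too.
        let l₀ , same = ∼-occurs 1≤N xψ∼yψ′ l in
        does-≡⇒→ (attains? l₀ (π x l₀) (ψ′ l)) (attains? l (π y l) (ψ′ l))
          (map-fromList-injective (cong proj₁ same) (∈-booleanVectors (ψ′ l)))
          (a l₀ , trans (respect κ l₀ (π-∷ a x l₀)) (cong proj₂ same))

      b : Structure.Carrier (∏ 𝒜)
      b l = proj₁ (witness l)

  -- Induction on formulas.

  eval-∏ : ∀ {n} (t : Term L n) (x : Elements n) l → A._≈_ l (eval (∏ 𝒜) x t l) (eval (𝒜 l) (π x l) t)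
  eval-∏ (var j)    x l = S.refl l
  eval-∏ (app g ts) x l = A.fun-cong l g (λ j → eval-∏ (ts j) x l)

  eval-cong : ∀ {n} (t : Term L n) l {v u} → Pointwise (A._≈_ l) v u →
    A._≈_ l (eval (𝒜 l) v t) (eval (𝒜 l) u t)
  eval-cong (var j)    l v≈u = v≈u j
  eval-cong (app g ts) l v≈u = A.fun-cong l g (λ j → eval-cong (ts j) l v≈u)

  sat-finitelyDetermined : ∀ {n} (φ : Formula L n) → FinitelyDetermined (Sat (∏ 𝒜) φ)
  sat-finitelyDetermined (t ≐ᶠ u) = FinitelyDetermined-⇔
    (λ x → mk⇔
      (λ eq → lift λ l → S.trans l (eval-∏ t x l) (S.trans l (eq l) (S.sym l (eval-∏ u x l))))
      (λ (lift eq) l → S.trans l (S.sym l (eval-∏ t x l)) (S.trans l (eq l) (eval-∏ u x l))))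
    (finitelyDetermined-coordinatewise (lowerExcludedMiddle w em) λ l v≈u eq →
      S.trans l (S.sym l (eval-cong t l v≈u)) (S.trans l eq (eval-cong u l v≈u)))
  sat-finitelyDetermined (relᶠ R ts) = FinitelyDetermined-⇔
    (λ x → mk⇔
      (λ holds → lift λ l → A.rel-resp l R (λ j → S.sym l (eval-∏ (ts j) x l)) (holds l))
      (λ (lift holds) l → A.rel-resp l R (λ j → eval-∏ (ts j) x l) (holds l)))
    (finitelyDetermined-coordinatewise (lowerExcludedMiddle w em) λ l v≈u →
      A.rel-resp l R (λ j → eval-cong (ts j) l v≈u))
  sat-finitelyDetermined (¬ᶠ φ) =
    let κ , N , det = sat-finitelyDetermined φ in
    κ , N , λ x∼y ¬φx φy → ¬φx (det (∼-sym x∼y) φy)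
  sat-finitelyDetermined (φ ∧ᶠ ψ) =
    let κ , N , detφ , detψ = determined-⊗ (sat-finitelyDetermined φ) (sat-finitelyDetermined ψ) in
    κ , N , λ x∼y → Product.map (detφ x∼y) (detψ x∼y)
  sat-finitelyDetermined (φ ∨ᶠ ψ) =
    let κ , N , detφ , detψ = determined-⊗ (sat-finitelyDetermined φ) (sat-finitelyDetermined ψ) in
    κ , N , λ x∼y → Sum.map (detφ x∼y) (detψ x∼y)
  sat-finitelyDetermined (φ ⇒ᶠ ψ) =
    let κ , N , detφ , detψ = determined-⊗ (sat-finitelyDetermined φ) (sat-finitelyDetermined ψ) in
    κ , N , λ x∼y φ⇒ψ φy → detψ x∼y (φ⇒ψ (detφ (∼-sym x∼y) φy))
  sat-finitelyDetermined (∀ᶠ φ) =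
    let κ , N , det = sat-finitelyDetermined φ in
    -- `suc N` supplies the positive bound for `back-and-forth`, as `N` is not known to be positive.
    -- The roles of `x` and `y` are exchanged because an element over `y` has to be matched over
    -- `x`.
    attainable κ , doubled (bits κ) (suc N) , λ x∼y ∀φ b →
      let a , yb∼xa = back-and-forth κ (s≤s z≤n) (∼-sym x∼y) b in
      det (∼-≤ (n≤1+n N) (∼-sym yb∼xa)) (∀φ a)
  sat-finitelyDetermined (∃ᶠ φ) =
    let κ , N , det = sat-finitelyDetermined φ in
    attainable κ , doubled (bits κ) (suc N) , λ x∼y (a , φa) →
      let b , xa∼yb = back-and-forth κ (s≤s z≤n) x∼y a in
      b , det (∼-≤ (n≤1+n N) xa∼yb) φa

  -- The parameters are fixed, so their values at `l` can be built into the colour function at `l`,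
  -- which may vary with `l`.
  finitelyDetermined-parameters : ∀ {n m p} {P : Pred (Elements (n + m)) p} (b : Elements m) →
    FinitelyDetermined P → FinitelyDetermined (λ x → P (x Vector.++ b))
  finitelyDetermined-parameters {n} {m} b (κ , N , det) =
    μ , N , λ {x} {y} x∼y → det (∼-++ x y x∼y)
    where
    ++-resp : ∀ l {v u : Vector (A.Carrier l) n} → Pointwise (A._≈_ l) v u →
      Pointwise (A._≈_ l) (v Vector.++ π b l) (u Vector.++ π b l)
    ++-resp l v≈u j with splitAt n j
    ... | inj₁ k = v≈u k
    ... | inj₂ _ = S.refl l

    π-++ : ∀ x l → Pointwise (A._≈_ l) (π x l Vector.++ π b l) (π (x Vector.++ b) l)
    π-++ x l j with splitAt n j
    ... | inj₁ _ = S.refl l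
    ... | inj₂ _ = S.refl l

    μ : Colouring n
    μ = record
      { bits    = bits κ
      ; colour  = λ l v → colour κ l (v Vector.++ π b l)
      ; respect = λ l v≈u → respect κ l (++-resp l v≈u)
      }

    ∼-++ : ∀ x y → colourOf μ x ∼⟨ N ⟩ colourOf μ y →
      colourOf κ (x Vector.++ b) ∼⟨ N ⟩ colourOf κ (y Vector.++ b)
    ∼-++ x y =
      ∼-coarsen id (λ l → sym (respect κ l (π-++ x l))) (λ l → sym (respect κ l (π-++ y l)))

  -- Open sets that count colours.

  AtLeastColoured : ∀ {n} (κ : Colouring n) → Vec Bool (bits κ) × ℕ → Pred (Elements n) w
  AtLeastColoured κ (d , k) x = Lift w (AtLeast k (Fibre (colourOf κ x) d))

  -- The witnessing list serves as the finite set of coordinates: a tuple that agrees with `x` there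
  -- has the same colours there, so the same list is a witness for it.
  atLeastColoured-open : ∀ {n} (κ : Colouring n) dk → IsOpen 𝒜 (AtLeastColoured κ dk)
  atLeastColoured-open κ (d , k) x (lift (ls , uls , dls , k≤)) =
    ls , (λ j l _ → x j l) , (λ l _ j → S.refl l) , λ y≈x → lift
      ( ls , uls
      , All.tabulate (λ {l} l∈ → trans (respect κ l (y≈x l l∈)) (All.lookup dls l∈)) , k≤)

  full-open : ∀ {n} → IsOpen 𝒜 {n} {w} (const (Lift w ⊤))
  full-open x _ = [] , (λ _ _ ()) , (λ _ ()) , const (lift tt)

  -- The sets `AtLeastColoured κ (d , k)` with `k ≤ N` record all counts truncated at `N`, so `P` is
  -- saturated for this finite family.
  finitelyDetermined⇒booleanCombination : ∀ {n} {P : Pred (Elements n) w} →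
    FinitelyDetermined P → IsBooleanCombinationOf (IsOpen 𝒜 {n} {w}) P
  finitelyDetermined⇒booleanCombination {n} (κ , N , det) =
    saturated⇒booleanCombination {p = w} {X = Elements n} (AtLeastColoured κ) em (atLeastColoured-open κ) full-open
      -- `upTo` excludes its bound, so `suc N` is what includes the threshold `N`.
      (cartesianProduct (booleanVectors (bits κ)) (upTo (suc N)))
      λ {y} {z} y≈z → det λ d →
        (λ k≤N → lower ∘ Equivalence.to (agree y z y≈z d k≤N) ∘ lift) ,
        (λ k≤N → lower ∘ Equivalence.from (agree y z y≈z d k≤N) ∘ lift)
    where
    agree : ∀ y z → Agree {p = w} {X = Elements n} (AtLeastColoured κ) _ y z →
      ∀ d {k} → k ≤ N → AtLeastColoured κ (d , k) y ⇔ AtLeastColoured κ (d , k) z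
    agree y z y≈z d k≤N = All.lookup y≈z (∈-cartesianProduct⁺ (∈-booleanVectors d) (∈-upTo⁺ (s≤s k≤N)))

theorem2p14 : ∀ {f r c e s i p : Level} →
    ExcludedMiddle (i ⊔ c ⊔ e ⊔ s) →
    (L : Language f r) (Λ : Set i) (𝒜 : Λ → Structure L c e s) →
    (n : ℕ) (S : Pred (Vector (Structure.Carrier (∏ 𝒜)) n) p) →
    Definable (∏ 𝒜) S →
    IsBooleanCombinationOf (IsOpen 𝒜 {n} {i ⊔ c ⊔ e ⊔ s}) S
theorem2p14 em L Λ 𝒜 n S (m , φ , b , S⇔φ) =
  let T , bc , φ⊆T , T⊆φ = finitelyDetermined⇒booleanCombination em 𝒜
        (finitelyDetermined-parameters em 𝒜 b (sat-finitelyDetermined em 𝒜 φ))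
  in  T , bc , (λ {x} → φ⊆T ∘ Equivalence.to (S⇔φ x)) , (λ {x} → Equivalence.from (S⇔φ x) ∘ T⊆φ)
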